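{- Let $G$ be a finite, connected, simple undirected graph with vertex set $V=\{v_0,\dots,v_n\}$ and edge set $E$, with $v_0$ chosen as sink. Let $\widetilde{V}=V\setminus\{v_0\}$, $X=\{v\in\widetilde{V}:\{v,v_0\}\notin E\}$, $1_X=\sum_{v\in X}v$, and let $K(G)_0$ be the graph $G$ with an edge $\{v,v_0\}$ added for each $v\in X$, with sink $v_0$. (1) Let $\mathcal{S}_0=\{c\in\mathcal{S}: c_{v_0}=-1 \text{ and } c+v_0\ge-1_X\}$. Then $$\psi(\mathbb{O}_0)=\{\tilde c-v_0:\ \tilde c\in\mathbb{Z}\widetilde V,\ \tilde c+1_X \text{ is a superstable configuration on } K(G)_0\}=\mathcal{S}_0.$$ (2) Let $\widetilde{\mathcal{S}}_0=\{c\in\mathcal{S}: c_{v_0}=-1\text{ and } c+v_0\ge0\}\subseteq\mathcal{S}_0$. Then $$\psi(\widetilde{\mathbb{O}}_0)=\{\tilde c-v_0:\ \tilde c \text{ a superstable configuration on } G\}=\{\tilde c-v_0:\ \tilde c+1_X\text{ superstable on }K(G)_0,\ \tilde c\ge0\}=\widetilde{\mathcal{S}}_0.$$ In particular $\psi(\widetilde{\mathbb{O}}_0)=\widetilde{\mathcal{S}}_0$ is the set of $G$-parking functions with respect to $v_0$.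
   Context: Sandpiles: for a graph $H$ with a chosen sink $s$, a configuration is an integer vector indexed by the nonsink vertices (identified with elements of the free abelian group on them); firing a set $Y$ of nonsink vertices from $c$ gives $c-\widetilde{\Delta}1_Y$, where $\widetilde{\Delta}$ is the Laplacian $D-A$ of $H$ with the sink's row and column removed. A configuration $c\ge0$ is superstable if there is no nonempty set $Y$ of nonsink vertices with $c-\widetilde{\Delta}1_Y\ge0$. Inequalities between divisors/configurations are componentwise. A divisor on $G$ is an element of $\mathbb{Z}V$; configurations on $G$ (sink $v_0$) are elements of $\mathbb{Z}\widetilde V\subseteq\mathbb{Z}V$. $K(G)$ is $G$ plus a new sink vertex $\tilde q$ adjacent to every vertex of $V$. $\mathcal{S}$ is the set of quasi-superstable divisors: $c\in\mathbb{Z}V$ with $c+1_V$ superstable on $K(G)$, $1_V=\sum_{v\in V}v$. A $G$-parking function with respect to $v_0$ is $f:V\to\mathbb{Z}$ with $f(v_0)=-1$ and $(f(v))_{v\in\widetilde V}$ superstable on $G$, identified with the divisor $\sum_v f(v)v$. Partial orientation: $\mathcal{O}\subseteq V\times V$ with $(u,v)\in\mathcal{O}\Rightarrow\{u,v\}\in E$, $(v,u)\notin\mathcal{O}$; non-oriented edges are blank; $\mathrm{indeg}_{\mathcal{O}}(v)$, $\mathrm{outdeg}_{\mathcal{O}}(v)$ count oriented edges into / out of $v$. A potential cycle is a cycle of $G$ whose blank edges can be directed to make it directed. $\mathbb{O}$ is the set of $G$-semiorientations (partial orientations all of whose potential cycles have more blank than oriented edges). $\mathbb{O}_0=\{\mathcal{O}\in\mathbb{O}:\mathrm{outdeg}_{\mathcal{O}}(v_0)=\deg(v_0)\}$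 and $\widetilde{\mathbb{O}}_0=\{\mathcal{O}\in\mathbb{O}_0:\mathrm{indeg}_{\mathcal{O}}(v_i)\ge1\ \forall i\neq0\}$. $\psi(\mathcal{O})=\sum_{v\in V}(\mathrm{indeg}_{\mathcal{O}}(v)-1)v$. -}

module Defs where

open import Data.Nat as ℕ using (ℕ; zero; suc)
open import Data.Integer as ℤ using (ℤ; +_; _-_; _+_; -_)
open import Data.Fin using (Fin; zero; suc)
open import Data.Bool using (Bool; true; false; _∧_; _∨_; not; if_then_else_)
open import Data.List using (List; []; _∷_; length; filter)
open import Data.List.Relation.Unary.All using (All)
open import Data.List.Relation.Unary.Unique.Propositional using (Unique)
open import Data.Product using (Σ; _×_; _,_; ∃)
open import Relation.Binary.PropositionalEquality using (_≡_)
open import Relation.Nullary using (¬_)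

count : ∀ {k} → (Fin k → Bool) → ℕ
count {zero}  p = 0
count {suc k} p = (if p zero then 1 else 0) ℕ.+ count (λ i → p (suc i))

Adj : ℕ → Set
Adj m = Fin m → Fin m → Bool

data Walk {m} (adj : Adj m) : Fin m → Fin m → Set where
  here : ∀ {u} → Walk adj u u
  step : ∀ {u w v} → adj u w ≡ true → Walk adj w v → Walk adj u v

-- finite, connected, simple undirected graph with vertices v₀ = zero, v₁ .. vₙ
record Graph (n : ℕ) : Set where
  field
    adj       : Adj (suc n)
    symmetric : ∀ u v → adj u v ≡ adj v u
    irrefl    : ∀ v → adj v v ≡ false
    connected : ∀ u v → Walk adj u v
open Graph public

deg : ∀ {m} → Adj m → Fin m → ℕ
deg adj v = count (λ u → adj v u)

-- Sandpiles on a simple graph H on Fin (suc N) with sink zero.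
-- Configurations are indexed by the nonsink vertices suc i, i : Fin N.

Config : ℕ → Set
Config N = Fin N → ℤ

-- (Δ̃ 1_Y)(i) for Y ⊆ nonsink vertices
lapInd : ∀ {N} → Adj (suc N) → (Fin N → Bool) → Fin N → ℤ
lapInd {N} H Y i =
  (if Y i then + deg H (suc i) else + 0) - + count (λ j → Y j ∧ H (suc i) (suc j))

Nonempty : ∀ {N} → (Fin N → Bool) → Set
Nonempty Y = ∃ λ i → Y i ≡ true

Superstable : ∀ {N} → Adj (suc N) → Config N → Set
Superstable {N} H c =
  (∀ i → + 0 ℤ.≤ c i) ×
  (∀ (Y : Fin N → Bool) → Nonempty Y → ¬ (∀ i → + 0 ℤ.≤ c i - lapInd H Y i))

Divisor : ℕ → Set
Divisor n = Fin (suc n) → ℤ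

-- K(G): new sink q̃ = zero, old vertex v is suc v, q̃ adjacent to all of V
K : ∀ {n} → Graph n → Adj (suc (suc n))
K G zero    zero    = false
K G zero    (suc v) = true
K G (suc u) zero    = true
K G (suc u) (suc v) = adj G u v

oneV : ∀ {n} → Divisor n
oneV _ = + 1

QuasiSuperstable : ∀ {n} → Graph n → Divisor n → Set
QuasiSuperstable G c = Superstable (K G) (λ v → c v + oneV v)

inX : ∀ {n} → Graph n → Fin (suc n) → Bool
inX G zero    = false
inX G (suc i) = not (adj G zero (suc i))

oneX : ∀ {n} → Graph n → Divisor n
oneX G v = if inX G v then + 1 else + 0

oneXc : ∀ {n} → Graph n → Config n
oneXc G i = oneX G (suc i)

v₀ : ∀ {n} → Divisor n
v₀ zero    = + 1
v₀ (suc _) = + 0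

K₀ : ∀ {n} → Graph n → Adj (suc n)
K₀ G u v = adj G u v ∨ (isZero u ∧ inX G v) ∨ (isZero v ∧ inX G u)
  where
  isZero : ∀ {n} → Fin (suc n) → Bool
  isZero zero    = true
  isZero (suc _) = false

cfgMinusV₀ : ∀ {n} → Config n → Divisor n
cfgMinusV₀ c zero    = - (+ 1)
cfgMinusV₀ c (suc i) = c i

record PartialOrientation {n} (G : Graph n) : Set where
  field
    O      : Fin (suc n) → Fin (suc n) → Bool
    onEdge : ∀ u v → O u v ≡ true → adj G u v ≡ true
    antisym : ∀ u v → O u v ≡ true → O v u ≡ false
open PartialOrientation public

indeg : ∀ {n} {G : Graph n} → PartialOrientation G → Fin (suc n) → ℕ
indeg 𝒪 v = count (λ u → O 𝒪 u v)

outdeg : ∀ {n} {G : Graph n} → PartialOrientation G → Fin (suc n) → ℕ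
outdeg 𝒪 v = count (λ u → O 𝒪 v u)

blank : ∀ {n} {G : Graph n} → PartialOrientation G → Fin (suc n) → Fin (suc n) → Bool
blank {G = G} 𝒪 u v = adj G u v ∧ not (O 𝒪 u v) ∧ not (O 𝒪 v u)

oriented : ∀ {n} {G : Graph n} → PartialOrientation G → Fin (suc n) → Fin (suc n) → Bool
oriented 𝒪 u v = O 𝒪 u v ∨ O 𝒪 v u

cycEdges : ∀ {A : Set} → List A → List (A × A)
cycEdges []       = []
cycEdges (x ∷ xs) = go x (x ∷ xs)
  where
  go : _ → List _ → List (_ × _)
  go x₀ []            = []
  go x₀ (a ∷ [])      = (a , x₀) ∷ []
  go x₀ (a ∷ b ∷ r)   = (a , b) ∷ go x₀ (b ∷ r)

record Cycle {n} (G : Graph n) : Set where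
  field
    verts    : List (Fin (suc n))
    long     : 3 ℕ.≤ length verts
    distinct : Unique verts
    edges    : All (λ e → adj G (Data.Product.proj₁ e) (Data.Product.proj₂ e) ≡ true)
                   (cycEdges verts)
open Cycle public

-- potential cycle (traversed in the listed direction): no edge oriented backwards,
-- so blank edges may be directed forwards to obtain a directed cycle.
-- (Both traversal directions are covered since the reversed list is also a Cycle.)
Potential : ∀ {n} {G : Graph n} → PartialOrientation G → Cycle G → Set
Potential 𝒪 C =
  All (λ e → O 𝒪 (Data.Product.proj₂ e) (Data.Product.proj₁ e) ≡ false) (cycEdges (verts C))

countEdges : ∀ {A : Set} → (A → A → Bool) → List (A × A) → ℕ
countEdges p es = length (filter (λ e → Data.Bool.T? (p (Data.Product.proj₁ e) (Data.Product.proj₂ e))) es)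

IsSemiorientation : ∀ {n} {G : Graph n} → PartialOrientation G → Set
IsSemiorientation {G = G} 𝒪 =
  ∀ (C : Cycle G) → Potential 𝒪 C →
    countEdges (oriented 𝒪) (cycEdges (verts C)) ℕ.< countEdges (blank 𝒪) (cycEdges (verts C))

In𝕆₀ : ∀ {n} {G : Graph n} → PartialOrientation G → Set
In𝕆₀ {G = G} 𝒪 = IsSemiorientation 𝒪 × outdeg 𝒪 zero ≡ deg (adj G) zero

In𝕆̃₀ : ∀ {n} {G : Graph n} → PartialOrientation G → Set
In𝕆̃₀ 𝒪 = In𝕆₀ 𝒪 × (∀ i → 1 ℕ.≤ indeg 𝒪 (suc i))

ψ : ∀ {n} {G : Graph n} → PartialOrientation G → Divisor n
ψ 𝒪 v = + indeg 𝒪 v - + 1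

ImageΨ : ∀ {n} (G : Graph n) → (PartialOrientation G → Set) → Divisor n → Set
ImageΨ G P d = Σ (PartialOrientation G) λ 𝒪 → P 𝒪 × (∀ v → d v ≡ ψ 𝒪 v)

ShiftedSet : ∀ {n} → (Config n → Set) → Divisor n → Set
ShiftedSet P d = Σ (Config _) λ c → P c × (∀ v → d v ≡ cfgMinusV₀ c v)

S₀ : ∀ {n} → Graph n → Divisor n → Set
S₀ G c = QuasiSuperstable G c × c zero ≡ - (+ 1) ×
         (∀ v → - oneX G v ℤ.≤ c v + v₀ v)

S̃₀ : ∀ {n} → Graph n → Divisor n → Set
S̃₀ G c = QuasiSuperstable G c × c zero ≡ - (+ 1) ×
         (∀ v → + 0 ℤ.≤ c v + v₀ v)

ParkingFunction : ∀ {n} → Graph n → Divisor n → Set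
ParkingFunction G f = f zero ≡ - (+ 1) × Superstable (adj G) (λ i → f (suc i))

{-# OPTIONS --safe #-}
module Submission where

-- All the sets of sandpiles reduce to one condition (Rigid): in every nonempty set Y of
-- nonsink vertices, some vertex has fewer chips than neighbours outside Y.
--
-- For an orientation, a set Y that could fire would have, at each of its vertices, an
-- edge oriented from within Y; walking backwards gives a directed cycle, which a
-- semiorientation does not have.
--
-- Conversely, prescribe in-degrees f and let fire start at v₀ and take a delay M along
-- every edge; v burns, at the time t v, as soon as the fire has arrived along f v edges.
-- Rigidity means that everything burns. Orient u → v when t u + M ≤ t v. Along a
-- potential cycle the time rises by at least M on oriented edges and falls by less than
-- M on blank ones, so there are more blank edges than oriented ones.

open import Defs
open import Data.Bool using (Bool; true; false; _∧_; _∨_; not; if_then_else_)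
open import Data.Bool.Properties using (¬-not; not-¬; not-involutive; ∨-identityʳ; ∧-zeroʳ)
  renaming (_≟_ to _≟ᵇ_)
open import Data.Fin using (Fin; zero; suc; toℕ; _≟_)
open import Data.Fin.Properties using (any?; 0≢1+n; suc-injective)
open import Data.Integer as ℤ using (ℤ; +_; -_; _+_; _-_; _≤_)
import Data.Integer.Properties as ℤ
open import Data.List using (List; []; _∷_; length; take)
open import Data.List.Membership.Propositional using (_∈_; _∉_)
open import Data.List.Relation.Unary.All as All using (All; []; _∷_)
open import Data.List.Relation.Unary.AllPairs using ([]; _∷_)
open import Data.List.Relation.Unary.All.Properties using (¬Any⇒All¬)
open import Data.List.Relation.Unary.Any using (here; there; index)
open import Data.List.Relation.Unary.Linked using (Linked; [-]; _∷_)
open import Data.List.Relation.Unary.Unique.Propositional using (Unique)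
open import Data.List.Relation.Unary.Unique.Propositional.Properties using (take⁺)
open import Data.Nat as ℕ using (ℕ; zero; suc; z≤n; s≤s)
import Data.Nat.Properties as ℕ
open import Data.Nat.Solver using (module +-*-Solver)
open import Data.Product using (_×_; _,_; ∃; proj₁; proj₂; uncurry)
open import Data.Sum using (_⊎_; inj₁; inj₂)
open import Function using (_∘_)
open import Function.Bundles using (_⇔_; mk⇔; Equivalence)
open import Function.Construct.Composition using (_⇔-∘_)
open import Function.Construct.Symmetry using (⇔-sym)
open import Relation.Binary.PropositionalEquality
open import Relation.Nullary using (¬_; Dec; yes; no; does; contradiction)
open import Relation.Nullary.Decidable using (_×-dec_; dec-true; dec-false; does-⇔)

-- Boolean predicates and counting

∧-intro : ∀ {a b} → a ≡ true → b ≡ true → a ∧ b ≡ true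
∧-intro refl refl = refl

∧-elim : ∀ {a b} → a ∧ b ≡ true → a ≡ true × b ≡ true
∧-elim {true} {true} refl = refl , refl

does-true : ∀ {A : Set} (a? : Dec A) → does a? ≡ true → A
does-true (yes a) _ = a

count-cong : ∀ {k} {p q : Fin k → Bool} → (∀ i → p i ≡ q i) → count p ≡ count q
count-cong {zero}  p≗q = refl
count-cong {suc k} p≗q rewrite p≗q zero = cong (_ ℕ.+_) (count-cong (p≗q ∘ suc))

count-mono : ∀ {k} {p q : Fin k → Bool} → (∀ i → p i ≡ true → q i ≡ true) →
             count p ℕ.≤ count q
count-mono {zero} p⇒q = z≤n
count-mono {suc k} {p} {q} p⇒q with p zero in p₀ | q zero in q₀
... | false | _    = ℕ.m≤n⇒m≤o+n _ (count-mono (p⇒q ∘ suc))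
... | true  | true = s≤s (count-mono (p⇒q ∘ suc))
... | true  | false with () ← trans (sym (p⇒q zero p₀)) q₀

count-mono-< : ∀ {k} {p q : Fin k → Bool} → (∀ i → p i ≡ true → q i ≡ true) →
               ∀ w → p w ≡ false → q w ≡ true → count p ℕ.< count q
count-mono-< p⇒q zero pw qw rewrite pw | qw = s≤s (count-mono (p⇒q ∘ suc))
count-mono-< {p = p} {q} p⇒q (suc w) pw qw with p zero in p₀ | q zero in q₀
... | false | false = count-mono-< (p⇒q ∘ suc) w pw qw
... | false | true  = ℕ.m<n⇒m<1+n (count-mono-< (p⇒q ∘ suc) w pw qw)
... | true  | true  = s≤s (count-mono-< (p⇒q ∘ suc) w pw qw)
... | true  | false with () ← trans (sym (p⇒q zero p₀)) q₀

count-none : ∀ {k} {p : Fin k → Bool} → (∀ i → p i ≡ false) → count p ≡ 0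
count-none {zero}  none = refl
count-none {suc k} none rewrite none zero = count-none (none ∘ suc)

-- The contrapositive of `count-mono`; the finite search by `any?` supplies the witness
-- constructively.
count-excess : ∀ {k} {p q : Fin k → Bool} → count p ℕ.< count q →
               ∃ λ i → q i ≡ true × p i ≡ false
count-excess {p = p} {q} p<q with any? (λ i → (q i ≟ᵇ true) ×-dec (p i ≟ᵇ false))
... | yes found = found
... | no none   = contradiction p<q (ℕ.≤⇒≯ (count-mono λ i qi → ¬-not λ pi → none (i , qi , pi)))

count-∃ : ∀ {k} {p : Fin k → Bool} → 1 ℕ.≤ count p → ∃ λ i → p i ≡ true
count-∃ {k} {p} 1≤p with count-excess {p = λ _ → false} {p}
                            (subst (ℕ._< count p) (sym (count-none λ (_ : Fin k) → refl)) 1≤p)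
... | i , pi , _ = i , pi

count-≥1 : ∀ {k} {p : Fin k → Bool} i → p i ≡ true → 1 ℕ.≤ count p
count-≥1 i pi = ℕ.≤-trans (s≤s z≤n) (count-mono-< {p = λ _ → false} (λ _ ()) i refl pi)

count-≤ : ∀ {k} (p : Fin k → Bool) → count p ℕ.≤ k
count-≤ {zero}  p = z≤n
count-≤ {suc k} p with p zero
... | true  = s≤s (count-≤ (p ∘ suc))
... | false = ℕ.m≤n⇒m≤1+n (count-≤ (p ∘ suc))

count-split : ∀ {k} (p q : Fin k → Bool) →
              count p ≡ count (λ i → p i ∧ not (q i)) ℕ.+ count (λ i → q i ∧ p i)
count-split {zero}  p q = refl
count-split {suc k} p q with p zero | q zero
... | false | false = count-split (p ∘ suc) (q ∘ suc)
... | false | true  = count-split (p ∘ suc) (q ∘ suc)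
... | true  | false = cong suc (count-split (p ∘ suc) (q ∘ suc))
... | true  | true  = trans (cong suc (count-split (p ∘ suc) (q ∘ suc))) (sym (ℕ.+-suc _ _))

count-subsingleton : ∀ {k} {p : Fin k → Bool} →
                     (∀ i j → p i ≡ true → p j ≡ true → i ≡ j) → count p ℕ.≤ 1
count-subsingleton {zero} unique = z≤n
count-subsingleton {suc k} {p} unique with p zero in p₀
... | false = count-subsingleton λ i j pi pj → suc-injective (unique (suc i) (suc j) pi pj)
... | true  = ℕ.≤-reflexive (cong suc (count-none λ i → ¬-not λ pi →
                0≢1+n (unique zero (suc i) p₀ pi)))

-- Serves one tick of the clock, with `p` and `q` the fires that have arrived before and after it.
count-≤suc : ∀ {k} {p q : Fin k → Bool} →
             (∀ i j → q i ≡ true → p i ≡ false → q j ≡ true → p j ≡ false → i ≡ j) →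
             count q ℕ.≤ suc (count p)
count-≤suc {p = p} {q} unique = begin
  count q                                                       ≡⟨ count-split q p ⟩
  count (λ i → q i ∧ not (p i)) ℕ.+ count (λ i → p i ∧ q i)
    ≤⟨ ℕ.+-mono-≤ (count-subsingleton λ i j ei ej → unique i j (new i ei .proj₁) (new i ei .proj₂)
                                                              (new j ej .proj₁) (new j ej .proj₂))
                  (count-mono {p = λ i → p i ∧ q i} λ i → proj₁ ∘ ∧-elim) ⟩
  suc (count p) ∎
  where
  open ℕ.≤-Reasoning
  new : ∀ i → q i ∧ not (p i) ≡ true → q i ≡ true × p i ≡ false
  new i e with q i | p i
  ... | true | false = refl , refl

-- Cycles

-- The local function of cycEdges, with its hidden parameters forgotten.
closing : ∀ {A : Set} → A → List A → List (A × A)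
closing x []          = []
closing x (a ∷ [])    = (a , x) ∷ []
closing x (a ∷ b ∷ r) = (a , b) ∷ closing x (b ∷ r)

-- The left-hand side of the second lemma cannot be named (it is local to cycEdges);
-- Agda infers it from the use in the first one.
mutual
  cycEdges-closing : ∀ {A : Set} (x : A) xs → cycEdges (x ∷ xs) ≡ closing x (x ∷ xs)
  cycEdges-closing x xs with x ∷ xs
  ... | l = local-closing x xs l

  local-closing : ∀ {A : Set} (x : A) xs l → _ ≡ closing x l
  local-closing x xs []          = refl
  local-closing x xs (a ∷ [])    = refl
  local-closing x xs (a ∷ b ∷ r) = cong ((a , b) ∷_) (local-closing x xs (b ∷ r))

module _ {m} {R : Fin m → Fin m → Set}
         (R-irrefl : ∀ {u} → ¬ R u u) (R-asym : ∀ {u v} → R u v → ¬ R v u) where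

  open import Data.List.Membership.DecPropositional (_≟_ {m}) using (_∈?_)

  DirectedCycle : List (Fin m) → Set
  DirectedCycle c = 3 ℕ.≤ length c × Unique c × All (uncurry R) (cycEdges c)

  private
    -- The list holds the walk with its newest vertex first, so following the list follows `R`. Cut
    -- at the position of `y`, it is a path ending in `y`, and the edge `R y x` closes it. The start
    -- `x` stays fixed while the recursion moves `a`.
    close-edges : ∀ {y} x a l (y∈ : y ∈ a ∷ l) → Linked R (a ∷ l) → R y x →
                  All (uncurry R) (closing x (a ∷ take (toℕ (index y∈)) l))
    close-edges x a l       (here refl) _              Ryx = Ryx ∷ []
    close-edges x a (b ∷ l) (there y∈)  (Rab ∷ linked) Ryx =
      Rab ∷ close-edges x b l y∈ linked Ryx

    -- Closing up after one vertex would contradict irreflexivity, after two vertices asymmetry.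
    close-long : ∀ {y} x l (y∈ : y ∈ x ∷ l) → Linked R (x ∷ l) → R y x →
                 3 ℕ.≤ length (x ∷ take (toℕ (index y∈)) l)
    close-long x l           (here refl)         _         Ryx = contradiction Ryx R-irrefl
    close-long x (b ∷ l)     (there (here refl)) (Rxy ∷ _) Ryx = contradiction Ryx (R-asym Rxy)
    close-long x (b ∷ c ∷ l) (there (there y∈))  _         _   = s≤s (s≤s (s≤s z≤n))

    unvisited : List (Fin m) → Fin m → Bool
    unvisited l u = not (does (u ∈? l))

    unvisited-∉ : ∀ l u → u ∉ l → unvisited l u ≡ true
    unvisited-∉ l u u∉ = cong not (dec-false (u ∈? l) u∉)

    unvisited-∈ : ∀ l u → u ∈ l → unvisited l u ≡ false
    unvisited-∈ l u u∈ = cong not (dec-true (u ∈? l) u∈)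

    unvisited-tail : ∀ x l u → unvisited (x ∷ l) u ≡ true → unvisited l u ≡ true
    unvisited-tail x l u e = unvisited-∉ l u λ u∈ → not-¬ (unvisited-∈ (x ∷ l) u (there u∈)) e

  -- Stepping back to predecessors within `Y` must at last revisit a vertex, as there are only `m`
  -- of them. In `go`, `N` exceeds the number of unvisited vertices and drops with every new one.
  backward-walk : ∀ (Y : Fin m → Set) → (∀ {v} → Y v → ∃ λ u → Y u × R u v) →
                  ∀ {v} → Y v → ∃ DirectedCycle
  backward-walk Y pred {v} Yv = go (suc m) v [] Yv [-] ([] ∷ []) (s≤s (count-≤ (unvisited (v ∷ []))))
    where
    go : ∀ N x l → Y x → Linked R (x ∷ l) → Unique (x ∷ l) →
         count (unvisited (x ∷ l)) ℕ.< N → ∃ DirectedCycle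
    go (suc N) x l Yx linked unique bound with pred Yx
    ... | y , Yy , Ryx with y ∈? (x ∷ l)
    ...   | yes y∈ = x ∷ take k l , close-long x l y∈ linked Ryx , take⁺ (suc k) unique ,
                     subst (All (uncurry R)) (sym (cycEdges-closing x (take k l)))
                           (close-edges x x l y∈ linked Ryx)
      where k = toℕ (index y∈)
    ...   | no y∉ = go N y (x ∷ l) Yy (Ryx ∷ linked) (¬Any⇒All¬ _ y∉ ∷ unique)
                       (ℕ.<-≤-trans (count-mono-< (unvisited-tail y (x ∷ l)) y
                          (unvisited-∈ (y ∷ x ∷ l) y (here refl)) (unvisited-∉ (x ∷ l) y y∉))
                                    (ℕ.s≤s⁻¹ bound))

-- Semiorientations from times

countEdges-∷ : ∀ {A : Set} (p : A → A → Bool) a b es →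
               countEdges p ((a , b) ∷ es) ≡ (if p a b then 1 else 0) ℕ.+ countEdges p es
countEdges-∷ p a b es with p a b
... | true  = refl
... | false = refl

countEdges-none : ∀ {A : Set} (p : A → A → Bool) es →
                  All (λ e → p (proj₁ e) (proj₂ e) ≡ false) es → countEdges p es ≡ 0
countEdges-none p []             []           = refl
countEdges-none p ((a , b) ∷ es) (none ∷ all) =
  trans (countEdges-∷ p a b es) (trans (cong (λ x → (if x then 1 else 0) ℕ.+ countEdges p es) none) (countEdges-none p es all))

module _ {n} {G : Graph n} (𝒪 : PartialOrientation G) where

  oriented-or-blank : ∀ u v → adj G u v ≡ true → O 𝒪 v u ≡ false →
    (O 𝒪 u v ≡ true × oriented 𝒪 u v ≡ true × blank 𝒪 u v ≡ false) ⊎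
    (O 𝒪 u v ≡ false × oriented 𝒪 u v ≡ false × blank 𝒪 u v ≡ true)
  oriented-or-blank u v uv vu with O 𝒪 u v | O 𝒪 v u | adj G u v
  oriented-or-blank u v refl refl | true  | false | true = inj₁ (refl , refl , refl)
  oriented-or-blank u v refl refl | false | false | true = inj₂ (refl , refl , refl)

  module _ (t : Fin (suc n) → ℕ) (M : ℕ) (0<M : 1 ℕ.≤ M)
           (late  : ∀ u v → O 𝒪 u v ≡ true → t u ℕ.+ M ℕ.≤ t v)
           (close : ∀ u v → adj G u v ≡ true → O 𝒪 u v ≡ false → t v ℕ.< t u ℕ.+ M) where

    private
      o b : List (Fin (suc n) × Fin (suc n)) → ℕ
      o = countEdges (oriented 𝒪)
      b = countEdges (blank 𝒪)

      Traversable : Fin (suc n) × Fin (suc n) → Set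
      Traversable (u , v) = adj G u v ≡ true × O 𝒪 v u ≡ false

      -- A walk with j oriented and k blank edges from a vertex at time x to one at time y.
      record Bound (x y j k : ℕ) : Set where
        constructor bound
        field
          nonempty : 1 ℕ.≤ j ℕ.+ k
          gain     : x ℕ.+ (j ℕ.* M ℕ.+ k) ℕ.≤ y ℕ.+ k ℕ.* M

      regroup : ∀ u j j′ k k′ → u ℕ.+ ((j ℕ.+ j′) ℕ.* M ℕ.+ (k ℕ.+ k′)) ≡
                                (u ℕ.+ (j ℕ.* M ℕ.+ k)) ℕ.+ (j′ ℕ.* M ℕ.+ k′)
      regroup u j j′ k k′ = solve 6 (λ u j j′ k k′ M →
          u :+ ((j :+ j′) :* M :+ (k :+ k′)) := (u :+ (j :* M :+ k)) :+ (j′ :* M :+ k′)) refl u j j′ k k′ M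
        where open +-*-Solver

      bound-∷ : ∀ {x y z j k j′ k′} → Bound x y j k → Bound y z j′ k′ →
                Bound x z (j ℕ.+ j′) (k ℕ.+ k′)
      bound-∷ {x} {y} {z} {j} {k} {j′} {k′} (bound 1≤ xy) (bound _ yz) =
        bound (ℕ.≤-trans 1≤ (ℕ.+-mono-≤ (ℕ.m≤m+n j j′) (ℕ.m≤m+n k k′))) (begin
        x ℕ.+ ((j ℕ.+ j′) ℕ.* M ℕ.+ (k ℕ.+ k′))            ≡⟨ regroup x j j′ k k′ ⟩
        (x ℕ.+ (j ℕ.* M ℕ.+ k)) ℕ.+ (j′ ℕ.* M ℕ.+ k′)      ≤⟨ ℕ.+-monoˡ-≤ _ xy ⟩
        (y ℕ.+ k ℕ.* M) ℕ.+ (j′ ℕ.* M ℕ.+ k′)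
          ≡⟨ solve 5 (λ y k j′ k′ M → (y :+ k :* M) :+ (j′ :* M :+ k′) := (y :+ (j′ :* M :+ k′)) :+ k :* M)
               refl y k j′ k′ M ⟩
        (y ℕ.+ (j′ ℕ.* M ℕ.+ k′)) ℕ.+ k ℕ.* M              ≤⟨ ℕ.+-monoˡ-≤ _ yz ⟩
        (z ℕ.+ k′ ℕ.* M) ℕ.+ k ℕ.* M
          ≡⟨ solve 4 (λ z k k′ M → (z :+ k′ :* M) :+ k :* M := z :+ (k :+ k′) :* M) refl z k k′ M ⟩
        z ℕ.+ (k ℕ.+ k′) ℕ.* M                             ∎)
        where
        open ℕ.≤-Reasoning
        open +-*-Solver

      ι : Bool → ℕ
      ι x = if x then 1 else 0

      -- An oriented edge gains at least `M` by `late`. A blank edge loses at most `M - 1`: this is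
      -- `close` for the reversed pair, which a potential cycle does not orient. `gain` is the
      -- estimate j * M ≤ (y - x) + k * (M - 1) with the subtractions cleared.
      bound-edge : ∀ u v → Traversable (u , v) → Bound (t u) (t v) (ι (oriented 𝒪 u v)) (ι (blank 𝒪 u v))
      bound-edge u v (uv , vu) with oriented-or-blank u v uv vu
      ... | inj₁ (Ouv , ouv , buv) rewrite ouv | buv = bound (s≤s z≤n)
        (subst₂ ℕ._≤_ (cong (t u ℕ.+_) (sym (trans (ℕ.+-identityʳ _) (ℕ.*-identityˡ M))))
                      (sym (ℕ.+-identityʳ (t v))) (late u v Ouv))
      ... | inj₂ (_ , ouv , buv) rewrite ouv | buv = bound (s≤s z≤n)
        (subst₂ ℕ._≤_ (ℕ.+-comm 1 (t u)) (cong (t v ℕ.+_) (sym (ℕ.*-identityˡ M)))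
                      (close v u (trans (symmetric G v u) uv) vu))

      bound-closing : ∀ x a l → All Traversable (closing x (a ∷ l)) →
                      Bound (t a) (t x) (o (closing x (a ∷ l))) (b (closing x (a ∷ l)))
      bound-closing x a [] (ax ∷ []) =
        subst₂ (Bound (t a) (t x))
          (sym (trans (countEdges-∷ (oriented 𝒪) a x []) (ℕ.+-identityʳ _)))
          (sym (trans (countEdges-∷ (blank 𝒪) a x []) (ℕ.+-identityʳ _)))
          (bound-edge a x ax)
      bound-closing x a (c ∷ l) (ac ∷ rest) =
        subst₂ (Bound (t a) (t x))
          (sym (countEdges-∷ (oriented 𝒪) a c _))
          (sym (countEdges-∷ (blank 𝒪) a c _))
          (bound-∷ (bound-edge a c ac) (bound-closing x c l rest))

      -- On a closed walk the times cancel, leaving j * M + k ≤ k * M. For positive k this gives j *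
      -- M < k * M. For k zero it forces j to be zero, against `nonempty`.
      bound⇒< : ∀ x j k → Bound x x j k → j ℕ.< k
      bound⇒< x j zero (bound 1≤ le) = contradiction 1≤ (ℕ.<⇒≱ (s≤s (ℕ.≤-reflexive j+0≡0)))
        where
        jM≤0 : j ℕ.* M ℕ.+ 0 ℕ.≤ 0
        jM≤0 = ℕ.+-cancelˡ-≤ x _ _ le
        j+0≡0 : j ℕ.+ 0 ≡ 0
        j+0≡0 = ℕ.n≤0⇒n≡0 (ℕ.≤-trans (ℕ.+-monoˡ-≤ 0 (ℕ.≤-trans (ℕ.≤-reflexive (sym (ℕ.*-identityʳ j)))
                                                          (ℕ.*-monoʳ-≤ j 0<M))) jM≤0)
      bound⇒< x j k@(suc k′) (bound _ le) = ℕ.*-cancelʳ-< M j k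
        (ℕ.<-≤-trans (ℕ.m<m+n (j ℕ.* M) (s≤s z≤n)) (ℕ.+-cancelˡ-≤ x _ _ le))

    times⇒semiorientation : IsSemiorientation 𝒪
    times⇒semiorientation C pot with verts C | long C | edges C
    ... | x ∷ l | _ | es rewrite cycEdges-closing x l =
      bound⇒< (t x) _ _ (bound-closing x x l (All.zip (es , pot)))

-- Burning

-- The left-hand side is the number of neighbours outside `Y`, the sink included: the chips that the
-- vertex loses when `Y` fires.
Fires : ∀ {N} → Adj (suc N) → Config N → (Fin N → Bool) → Set
Fires H c Y = ∀ i → Y i ≡ true →
  + deg H (suc i) - + count (λ j → Y j ∧ H (suc i) (suc j)) ≤ c i

-- Nonnegativity is kept apart, because the two families of sets in the theorem share this condition
-- and differ only in a lower bound on the chips.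
Rigid : ∀ {N} → Adj (suc N) → Config N → Set
Rigid H c = ∀ Y → Nonempty Y → ¬ Fires H c Y

+[m+n]-n : ∀ m n → + (m ℕ.+ n) - + n ≡ + m
+[m+n]-n m n = trans (cong (_- + n) (ℤ.pos-+ m n)) (trans (ℤ.+-assoc (+ m) (+ n) (- + n))
                 (trans (cong (ℤ._+_ (+ m)) (ℤ.+-inverseʳ (+ n))) (ℤ.+-identityʳ (+ m))))

-- For z equal to 2y or 2y + 1, half of z rounds down to y. Both cases occur once the time scale is
-- doubled: old burning times become even and the new one is odd.
double-≤ : ∀ x y {z} → y ℕ.+ y ℕ.≤ z → z ℕ.≤ suc (y ℕ.+ y) → x ℕ.≤ y ⇔ x ℕ.+ x ℕ.≤ z
double-≤ x y {z} lo hi = mk⇔ (λ x≤y → ℕ.≤-trans (ℕ.+-mono-≤ x≤y x≤y) lo)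
                                 (λ xx≤z → ℕ.≮⇒≥ λ y<x → ℕ.<-irrefl refl (begin-strict
  suc (y ℕ.+ y)       <⟨ ℕ.n<1+n _ ⟩
  suc (suc (y ℕ.+ y)) ≡⟨ cong suc (ℕ.+-suc y y) ⟨
  suc y ℕ.+ suc y     ≤⟨ ℕ.+-mono-≤ y<x y<x ⟩
  x ℕ.+ x             ≤⟨ xx≤z ⟩
  z                   ≤⟨ hi ⟩
  suc (y ℕ.+ y)       ∎))
  where open ℕ.≤-Reasoning

double-injective : ∀ x y → x ℕ.+ x ≡ y ℕ.+ y → x ≡ y
double-injective x y e = ℕ.≤-antisym
  (Equivalence.from (double-≤ x y ℕ.≤-refl (ℕ.n≤1+n _)) (ℕ.≤-reflexive e))
  (Equivalence.from (double-≤ y x ℕ.≤-refl (ℕ.n≤1+n _)) (ℕ.≤-reflexive (sym e)))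

-- Keeps the new, odd burning time distinct from the doubled ones.
odd≢even : ∀ x y → suc (x ℕ.+ x) ≢ y ℕ.+ y
odd≢even x y e with double-injective x y (ℕ.≤-antisym xx≤yy yy≤xx)
  where
  xx≤yy = ℕ.≤-trans (ℕ.n≤1+n _) (ℕ.≤-reflexive e)
  y≤x = Equivalence.from (double-≤ y x (ℕ.n≤1+n (x ℕ.+ x)) ℕ.≤-refl) (ℕ.≤-reflexive (sym e))
  yy≤xx = ℕ.+-mono-≤ y≤x y≤x
... | refl = ℕ.1+n≢n e

module Burning {n} (G : Graph n) (f : Fin (suc n) → ℕ) (f₀ : f zero ≡ 0)
               (rigid : Rigid (adj G) (λ i → + f (suc i) - + 1)) where

  V : Set
  V = Fin (suc n)

  received : (V → Bool) → (V → ℕ) → ℕ → ℕ → V → ℕ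
  received B t M T v = count (λ u → B u ∧ adj G v u ∧ does (t u ℕ.+ M ℕ.≤? T))

  -- Fire started at the time t u reaches the neighbours of u with delay M;
  -- B is the set of vertices burnt up to the present time T.
  record State : Set where
    field
      B        : V → Bool
      t        : V → ℕ
      M T      : ℕ
      0<M      : 1 ℕ.≤ M
      root     : t zero ≡ 0
      burnt₀   : B zero ≡ true
      past     : ∀ u → B u ≡ true → t u ℕ.≤ T
      separate : ∀ u v → B u ≡ true → B v ≡ true → t u ≡ t v → u ≡ v
      exact    : ∀ v → B v ≡ true → received B t M (t v) v ≡ f v
      waiting  : ∀ v → B v ≡ false → received B t M T v ℕ.≤ f v

  isRoot : V → Bool
  isRoot zero    = true
  isRoot (suc _) = false

  start : State
  start = record
    { B = isRoot
    -- Only the value at the root matters; elsewhere it is a placeholder until the vertex burns.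
    ; t = λ _ → 0
    ; M = 1 ; T = 0
    ; 0<M = s≤s z≤n
    ; root = refl
    ; burnt₀ = refl
    ; past = λ _ _ → z≤n
    ; separate = λ { zero zero _ _ _ → refl }
    ; exact = λ { zero _ → trans (nothing zero) (sym f₀) }
    ; waiting = λ v _ → subst (ℕ._≤ f v) (sym (nothing v)) z≤n
    }
    where
    nothing : ∀ v → received isRoot (λ _ → 0) 1 0 v ≡ 0
    nothing v = count-none {p = λ u → isRoot u ∧ adj G v u ∧ false}
                           λ { zero → ∧-zeroʳ (adj G v zero) ; (suc _) → refl }

  module _ (s : State) where
    open State s

    -- At most one fire arrives at any given time, so no waiting vertex overshoots.
    tick : (∀ v → B v ≡ false → received B t M T v ≢ f v) → State
    tick idle = record
      { B = B ; t = t ; M = M ; T = suc T ; 0<M = 0<M ; root = root ; burnt₀ = burnt₀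
      ; past = λ u Bu → ℕ.m≤n⇒m≤1+n (past u Bu)
      ; separate = separate
      ; exact = exact
      ; waiting = λ v Bv → ℕ.≤-trans (count-≤suc (λ i j qi pi qj pj →
          separate i j (proj₁ (∧-elim {B i} qi)) (proj₁ (∧-elim {B j} qj))
            (ℕ.+-cancelʳ-≡ M _ _ (trans (arrival v i qi pi) (sym (arrival v j qj pj))))))
          -- Not being ready makes `waiting` strict, which leaves room for the one new arrival.
          (ℕ.≤∧≢⇒< (waiting v Bv) (idle v Bv))
      }
      where
      arrival : ∀ v i → B i ∧ adj G v i ∧ does (t i ℕ.+ M ℕ.≤? suc T) ≡ true →
                B i ∧ adj G v i ∧ does (t i ℕ.+ M ℕ.≤? T) ≡ false → t i ℕ.+ M ≡ suc T
      arrival v i qi pi with ∧-elim {B i} qi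
      ... | Bi , r with ∧-elim {adj G v i} r
      ... | vi , le = ℕ.≤-antisym (does-true (t i ℕ.+ M ℕ.≤? suc T) le)
        (ℕ.≰⇒> λ le′ → not-¬ pi (∧-intro {B i} Bi (∧-intro {adj G v i} vi (dec-true (t i ℕ.+ M ℕ.≤? T) le′))))

    -- Doubling the time scale makes room for a burning time strictly between T and T + 1.
    module _ (w : V) (Bw : B w ≡ false) (ready : received B t M T w ≡ f w) where

      private
        B′ : V → Bool
        B′ u = does (u ≟ w) ∨ B u

        t′ : V → ℕ
        t′ u = if does (u ≟ w) then suc (T ℕ.+ T) else t u ℕ.+ t u

        M′ T′ : ℕ
        M′ = M ℕ.+ M
        T′ = suc (T ℕ.+ T)

        0<M′ : 1 ℕ.≤ M′
        0<M′ = ℕ.≤-trans 0<M (ℕ.m≤m+n M M)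

        -- The fire of `w` itself arrives only after `S′`, since `S′` is at most `T′` and the delay
        -- is positive. For every other vertex `double-≤` shows that the doubled clock gives the
        -- same answer.
        received′ : ∀ S S′ v → S ℕ.≤ T → S ℕ.+ S ℕ.≤ S′ → S′ ℕ.≤ suc (S ℕ.+ S) →
                    received B′ t′ M′ S′ v ≡ received B t M S v
        received′ S S′ v S≤T lo hi = count-cong same
          where
          same : ∀ u → B′ u ∧ adj G v u ∧ does (t′ u ℕ.+ M′ ℕ.≤? S′) ≡
                       B u ∧ adj G v u ∧ does (t u ℕ.+ M ℕ.≤? S)
          same u with u ≟ w
          ... | yes refl rewrite Bw
                  | dec-false (T′ ℕ.+ M′ ℕ.≤? S′) (ℕ.<⇒≱ (ℕ.≤-<-trans hi
                      (ℕ.≤-<-trans (s≤s (ℕ.+-mono-≤ S≤T S≤T)) (ℕ.m<m+n T′ 0<M′)))) =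
            ∧-zeroʳ (adj G v u)
          ... | no _ = cong (λ x → B u ∧ adj G v u ∧ x) (sym (does-⇔
                  (subst (λ x → t u ℕ.+ M ℕ.≤ S ⇔ x ℕ.≤ S′) (regroup (t u) M) (double-≤ (t u ℕ.+ M) S lo hi))
                  (t u ℕ.+ M ℕ.≤? S) (t u ℕ.+ t u ℕ.+ M′ ℕ.≤? S′)))
            where
            regroup : ∀ a m → (a ℕ.+ m) ℕ.+ (a ℕ.+ m) ≡ (a ℕ.+ a) ℕ.+ (m ℕ.+ m)
            regroup a m = solve 2 (λ a m → (a :+ m) :+ (a :+ m) := (a :+ a) :+ (m :+ m)) refl a m
              where open +-*-Solver

        received-now : ∀ v → received B′ t′ M′ T′ v ≡ received B t M T v
        received-now v = received′ T T′ v ℕ.≤-refl (ℕ.n≤1+n _) ℕ.≤-refl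

      burn : State
      burn = record
        { B = B′ ; t = t′ ; M = M′ ; T = T′ ; 0<M = 0<M′
        ; root = root′ ; burnt₀ = burnt₀′ ; past = past′
        ; separate = separate′ ; exact = exact′ ; waiting = waiting′ }
        where
        root′ : t′ zero ≡ 0
        root′ with zero ≟ w
        ... | yes refl with () ← trans (sym burnt₀) Bw
        ... | no _ rewrite root = refl

        burnt₀′ : B′ zero ≡ true
        burnt₀′ with zero ≟ w
        ... | yes _ = refl
        ... | no _ = burnt₀

        past′ : ∀ u → B′ u ≡ true → t′ u ℕ.≤ T′
        past′ u B′u with u ≟ w
        ... | yes _ = ℕ.≤-refl
        ... | no _ = ℕ.m≤n⇒m≤1+n (ℕ.+-mono-≤ (past u B′u) (past u B′u))

        separate′ : ∀ u v → B′ u ≡ true → B′ v ≡ true → t′ u ≡ t′ v → u ≡ v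
        separate′ u v B′u B′v e with u ≟ w | v ≟ w
        ... | yes u≡w | yes v≡w = trans u≡w (sym v≡w)
        ... | yes _   | no _    = contradiction e (odd≢even T (t v))
        ... | no _    | yes _   = contradiction (sym e) (odd≢even T (t u))
        ... | no _    | no _    = separate u v B′u B′v (double-injective (t u) (t v) e)

        exact′ : ∀ v → B′ v ≡ true → received B′ t′ M′ (t′ v) v ≡ f v
        exact′ v B′v = by-cases (v ≟ w) refl
          where
          by-cases : (d : Dec (v ≡ w)) → (v ≟ w) ≡ d → received B′ t′ M′ (t′ v) v ≡ f v
          by-cases (yes refl) e = trans (cong (λ S → received B′ t′ M′ S v) t′v)
                                        (trans (received-now v) ready)
            where
            t′v : t′ v ≡ T′
            t′v rewrite e = refl
          by-cases (no v≢w) e = trans (cong (λ S → received B′ t′ M′ S v) t′v)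
            (trans (received′ (t v) _ v (past v Bv) ℕ.≤-refl (ℕ.n≤1+n _)) (exact v Bv))
            where
            t′v : t′ v ≡ t v ℕ.+ t v
            t′v rewrite e = refl
            Bv : B v ≡ true
            Bv = trans (sym (cong (λ d → does d ∨ B v) e)) B′v

        waiting′ : ∀ v → B′ v ≡ false → received B′ t′ M′ T′ v ℕ.≤ f v
        waiting′ v B′v = subst (ℕ._≤ f v) (sym (received-now v)) (waiting v Bv)
          where
          Bv : B v ≡ false
          Bv with v ≟ w
          ... | no _ = B′v

  unburnt : (V → Bool) → ℕ
  unburnt B = count (λ u → not (B u))

  unburnt-burn : ∀ s w Bw ready → unburnt (State.B (burn s w Bw ready)) ℕ.< unburnt (State.B s)
  unburnt-burn s w Bw ready = count-mono-< shrink w now (cong not Bw)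
    where
    open State s
    shrink : ∀ u → not (does (u ≟ w) ∨ B u) ≡ true → not (B u) ≡ true
    shrink u e with u ≟ w
    ... | no _ = e
    now : not (does (w ≟ w) ∨ B w) ≡ false
    now rewrite dec-true (w ≟ w) refl = refl

  -- Once every fire has arrived, idleness means that the unburnt set can fire.
  idle-impossible : ∀ s → let open State s in
    (∀ u → B u ≡ true → t u ℕ.+ M ℕ.≤ T) →
    (∀ v → B v ≡ false → received B t M T v ≢ f v) →
    ∀ v → B v ≢ false
  idle-impossible s arrived idle v Bv = rigid Y (nonempty v Bv) fires
    where
    open State s
    Y : Fin n → Bool
    Y i = not (B (suc i))

    nonempty : ∀ v → B v ≡ false → Nonempty Y
    nonempty zero    Bv with () ← trans (sym burnt₀) Bv
    nonempty (suc i) Bv = i , cong not Bv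

    fires : Fires (adj G) (λ i → + f (suc i) - + 1) Y
    fires i Yi = subst (_≤ + f v′ - + 1) (sym (trans (cong (λ d → + d - + inner) deg≡) (+[m+n]-n r inner)))
                       (bounded (ℕ.≤∧≢⇒< (waiting v′ Bv′) (idle v′ Bv′)))
      where
      v′ = suc i
      inner = count (λ j → Y j ∧ adj G v′ (suc j))
      r = received B t M T v′

      Bv′ : B v′ ≡ false
      Bv′ = trans (sym (not-involutive (B v′))) (cong not Yi)

      -- By `arrived` the test on times always succeeds: the fires received are exactly the burnt
      -- neighbours, that is, those outside `Y`.
      outer≡ : ∀ u → adj G v′ u ∧ not (not (B u)) ≡ B u ∧ adj G v′ u ∧ does (t u ℕ.+ M ℕ.≤? T)
      outer≡ u with B u in Bu
      ... | false = ∧-zeroʳ (adj G v′ u)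
      ... | true  = cong (adj G v′ u ∧_) (sym (dec-true (t u ℕ.+ M ℕ.≤? T) (arrived u Bu)))

      -- The root is burnt, so dropping it from the count changes nothing.
      inner≡ : count (λ u → not (B u) ∧ adj G v′ u) ≡ inner
      inner≡ rewrite burnt₀ = refl

      deg≡ : deg (adj G) v′ ≡ r ℕ.+ inner
      deg≡ = trans (count-split (adj G v′) (λ u → not (B u))) (cong₂ ℕ._+_ (count-cong outer≡) inner≡)

      bounded : ∀ {r m} → r ℕ.< m → + r ≤ + m - + 1
      bounded (s≤s r≤m) = ℤ.+≤+ r≤m

  -- Lexicographic recursion: `N` bounds the unburnt vertices and `k` the ticks until every fire lit
  -- so far has arrived. A burning lowers `N` and resets `k` to the current delay; a tick lowers
  -- `k`. With `k` at zero and no vertex ready, `idle-impossible` applies.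
  burn-all : ∀ N k s → let open State s in
    unburnt B ℕ.≤ N → (∀ u → B u ≡ true → t u ℕ.+ M ℕ.≤ T ℕ.+ k) →
    ∃ λ s′ → ∀ v → State.B s′ v ≡ true
  burn-all N k s few due with any? (λ v →
    let open State s in (B v ≟ᵇ false) ×-dec (received B t M T v ℕ.≟ f v))
  burn-all zero k s few due | yes (w , Bw , ready) =
    contradiction (ℕ.<-≤-trans (unburnt-burn s w Bw ready) few) ℕ.n≮0
  burn-all (suc N) k s few due | yes (w , Bw , ready) =
    burn-all N (State.M s′) s′ (ℕ.s≤s⁻¹ (ℕ.<-≤-trans (unburnt-burn s w Bw ready) few))
             (λ u Bu → ℕ.+-monoˡ-≤ (State.M s′) (State.past s′ u Bu))
    where s′ = burn s w Bw ready
  burn-all N zero s few due | no none =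
    s , λ v → ¬-not (idle-impossible s (λ u Bu → subst (State.t s u ℕ.+ State.M s ℕ.≤_) (ℕ.+-identityʳ _) (due u Bu))
                                       (λ v Bv e → none (v , Bv , e)) v)
  burn-all N (suc k) s few due | no none =
    burn-all N k (tick s λ v Bv e → none (v , Bv , e)) few
             (λ u Bu → subst (State.t s u ℕ.+ State.M s ℕ.≤_) (ℕ.+-suc (State.T s) k) (due u Bu))

  realise : (∀ i → adj G zero (suc i) ≡ true → 1 ℕ.≤ f (suc i)) →
            ∃ λ (𝒪 : PartialOrientation G) → In𝕆₀ 𝒪 × (∀ v → indeg 𝒪 v ≡ f v)
  -- The delay starts at 1, so the fire of the root arrives after one tick.
  realise f≥1 with burn-all (suc n) 1 start (count-≤ (λ u → not (isRoot u))) (λ _ _ → ℕ.≤-refl)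
  ... | s , burnt = 𝒪 , (times⇒semiorientation 𝒪 t M 0<M late close , count-cong all-out) , indeg≡
    where
    open State s

    hot : V → V → Bool
    hot u v = does (t u ℕ.+ M ℕ.≤? t v)

    hot⇒< : ∀ u v → hot u v ≡ true → t u ℕ.< t v
    hot⇒< u v h = ℕ.<-≤-trans (ℕ.m<m+n (t u) 0<M) (does-true (t u ℕ.+ M ℕ.≤? t v) h)

    𝒪 : PartialOrientation G
    𝒪 = record
      { O = λ u v → adj G u v ∧ hot u v
      ; onEdge = λ u v Ouv → proj₁ (∧-elim Ouv)
      ; antisym = λ u v Ouv → ¬-not λ Ovu → ℕ.<-asym (hot⇒< u v (proj₂ (∧-elim {adj G u v} Ouv)))
                                                      (hot⇒< v u (proj₂ (∧-elim {adj G v u} Ovu)))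
      }

    late : ∀ u v → adj G u v ∧ hot u v ≡ true → t u ℕ.+ M ℕ.≤ t v
    late u v Ouv = does-true (t u ℕ.+ M ℕ.≤? t v) (proj₂ (∧-elim {adj G u v} Ouv))

    close : ∀ u v → adj G u v ≡ true → adj G u v ∧ hot u v ≡ false → t v ℕ.< t u ℕ.+ M
    close u v uv Ouv = ℕ.≰⇒> λ le → not-¬ Ouv (∧-intro uv (dec-true (t u ℕ.+ M ℕ.≤? t v) le))

    -- The fires that have reached `v` when it burns are the edges oriented into it, and `exact`
    -- counts them.
    indeg≡ : ∀ v → indeg 𝒪 v ≡ f v
    indeg≡ v = trans (count-cong same) (exact v (burnt v))
      where
      same : ∀ u → adj G u v ∧ hot u v ≡ B u ∧ adj G v u ∧ hot u v
      same u rewrite burnt u | symmetric G u v = refl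

    all-out : ∀ v → adj G zero v ∧ hot zero v ≡ adj G zero v
    all-out zero rewrite irrefl G zero = refl
    all-out (suc i) with adj G zero (suc i) in 0~i
    ... | false = refl
    -- Some edge enters this neighbour of the root, from a vertex `u` burning no earlier than time
    -- 0, so it burns at time `M` or later and its edge from the root is oriented too.
    ... | true with count-∃ {p = λ u → O 𝒪 u (suc i)} (subst (1 ℕ.≤_) (sym (indeg≡ (suc i))) (f≥1 i 0~i))
    ...   | u , Oui = dec-true (t zero ℕ.+ M ℕ.≤? t (suc i))
            (ℕ.≤-trans (ℕ.+-monoˡ-≤ M (subst (ℕ._≤ t u) (sym root) z≤n)) (late u (suc i) Oui))

-- Superstability as rigidity

fires-cong : ∀ {N} {H : Adj (suc N)} {c c′ : Config N} {Y} → (∀ i → c i ≡ c′ i) →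
             Fires H c Y → Fires H c′ Y
fires-cong c≗c′ fires i Yi = subst (_ ≤_) (c≗c′ i) (fires i Yi)

rigid-cong : ∀ {N} {H : Adj (suc N)} {c c′ : Config N} → (∀ i → c i ≡ c′ i) →
             Rigid H c → Rigid H c′
rigid-cong {H = H} c≗c′ rigid Y ne = rigid Y ne ∘ fires-cong {H = H} {Y = Y} (sym ∘ c≗c′)

-- Firing `Y` only adds chips outside `Y`, so nonnegativity of `c` settles legality there.
superstable⇔rigid : ∀ {N} (H : Adj (suc N)) (c : Config N) →
                    Superstable H c ⇔ ((∀ i → + 0 ≤ c i) × Rigid H c)
superstable⇔rigid H c = mk⇔
  (λ (c≥0 , stable) → c≥0 , λ Y ne fires → stable Y ne (fires⇒legal Y c≥0 fires))
  (λ (c≥0 , rigid)  → c≥0 , λ Y ne legal → rigid Y ne (legal⇒fires Y legal))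
  where
  fires⇒legal : ∀ Y → (∀ i → + 0 ≤ c i) → Fires H c Y → ∀ i → + 0 ≤ c i - lapInd H Y i
  fires⇒legal Y c≥0 fires i with Y i in Yi
  ... | true  = ℤ.i≤j⇒0≤j-i (fires i Yi)
  ... | false = ℤ.i≤j⇒0≤j-i (ℤ.≤-trans (ℤ.i≤j⇒i-j≤0 {+ 0} {+ count (λ j → Y j ∧ H (suc i) (suc j))} (ℤ.+≤+ z≤n)) (c≥0 i))

  legal⇒fires : ∀ Y → (∀ i → + 0 ≤ c i - lapInd H Y i) → Fires H c Y
  legal⇒fires Y legal i Yi with Y i | Yi | legal i
  ... | true | _ | 0≤ = ℤ.0≤i-j⇒j≤i 0≤

shift-≤ : ∀ x a b c → (x + a) - b ≤ c + x ⇔ a - b ≤ c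
shift-≤ x a b c = mk⇔
  (λ le → subst₂ _≤_ (cancel (a - b)) (cancel c) (ℤ.+-monoˡ-≤ (- x) (subst (_≤ c + x) regroup le)))
  (λ le → subst (_≤ c + x) (sym regroup) (ℤ.+-monoˡ-≤ x le))
  where
  regroup : (x + a) - b ≡ (a - b) + x
  regroup = trans (ℤ.+-assoc x a (- b)) (ℤ.+-comm x (a - b))
  cancel : ∀ y → (y + x) - x ≡ y
  cancel y = trans (ℤ.+-assoc y x (- x)) (trans (cong (ℤ._+_ y) (ℤ.+-inverseʳ x)) (ℤ.+-identityʳ y))

module _ {n} (G : Graph n) where

  -- Adding oneX compensates exactly the edges to the sink that K₀ G adds.
  K₀-fires : ∀ c Y → Fires (K₀ G) (λ i → c i + oneXc G i) Y ⇔ Fires (adj G) c Y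
  K₀-fires c Y = mk⇔ (λ fires i Yi → Equivalence.to   (same i) (fires i Yi))
                     (λ fires i Yi → Equivalence.from (same i) (fires i Yi))
    where
    inner≡ : ∀ i → count (λ j → Y j ∧ K₀ G (suc i) (suc j)) ≡ count (λ j → Y j ∧ adj G (suc i) (suc j))
    inner≡ i = count-cong λ j → cong (Y j ∧_) (∨-identityʳ (adj G (suc i) (suc j)))

    deg≡ : ∀ i → + deg (K₀ G) (suc i) ≡ oneXc G i + + deg (adj G) (suc i)
    deg≡ i rewrite count-cong (λ j → ∨-identityʳ (adj G (suc i) (suc j))) | symmetric G zero (suc i)
      with adj G (suc i) zero
    ... | true  = refl
    ... | false = refl

    same : ∀ i → + deg (K₀ G) (suc i) - + count (λ j → Y j ∧ K₀ G (suc i) (suc j)) ≤ c i + oneXc G i ⇔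
                 + deg (adj G) (suc i) - + count (λ j → Y j ∧ adj G (suc i) (suc j)) ≤ c i
    same i rewrite inner≡ i | deg≡ i = shift-≤ (oneXc G i) (+ deg (adj G) (suc i)) _ (c i)

  -- The chip added at each vertex pays for its new edge to the sink of `K G`. The old sink then
  -- holds no chip but always has the new sink as an outside neighbour, so no set containing it can
  -- fire.
  K-rigid : ∀ d → d zero ≡ - (+ 1) → Rigid (K G) (λ v → d v + oneV v) ⇔ Rigid (adj G) (d ∘ suc)
  K-rigid d d₀ = mk⇔ restrict extend
    where
    same : ∀ v k → + suc (deg (adj G) v) - + k ≤ d v + + 1 ⇔ + deg (adj G) v - + k ≤ d v
    same v k = shift-≤ (+ 1) (+ deg (adj G) v) (+ k) (d v)

    restrict : Rigid (K G) (λ v → d v + oneV v) → Rigid (adj G) (d ∘ suc)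
    restrict rigid Y (i , Yi) fires = rigid Y⁺ (suc i , Yi) fires⁺
      where
      Y⁺ : Fin (suc n) → Bool
      Y⁺ zero    = false
      Y⁺ (suc j) = Y j
      fires⁺ : Fires (K G) (λ v → d v + oneV v) Y⁺
      fires⁺ (suc j) Yj = Equivalence.from (same (suc j) (count (λ i → Y i ∧ adj G (suc j) (suc i)))) (fires j Yj)

    extend : Rigid (adj G) (d ∘ suc) → Rigid (K G) (λ v → d v + oneV v)
    extend rigid Y (v , Yv) fires with Y zero ≟ᵇ true
    ... | yes Y₀ = contradiction (subst₂ _≤_ deg≡ (cong (_+ + 1) d₀) (fires zero Y₀)) λ { (ℤ.+≤+ ()) }
      where
      inner = count (λ u → Y u ∧ adj G zero u)
      deg≡ : + suc (deg (adj G) zero) - + inner ≡ + suc (count (λ u → adj G zero u ∧ not (Y u)))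
      deg≡ = trans (cong (λ k → + suc k - + inner) (count-split (adj G zero) Y)) (+[m+n]-n _ inner)
    ... | no Y₀≢true = rigid (Y ∘ suc) (nonempty v Yv) fires⁻
      where
      Y₀ : Y zero ≡ false
      Y₀ = ¬-not Y₀≢true
      nonempty : ∀ v → Y v ≡ true → Nonempty (Y ∘ suc)
      nonempty zero    Yv = contradiction Yv Y₀≢true
      nonempty (suc i) Yv = i , Yv
      inner≡ : ∀ i → count (λ u → Y u ∧ adj G (suc i) u) ≡ count (λ j → Y (suc j) ∧ adj G (suc i) (suc j))
      inner≡ i rewrite Y₀ = refl
      fires⁻ : Fires (adj G) (d ∘ suc) (Y ∘ suc)
      fires⁻ i Yi = Equivalence.to (same (suc i) (count (λ j → Y (suc j) ∧ adj G (suc i) (suc j))))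
                      (subst (λ k → + suc (deg (adj G) (suc i)) - + k ≤ d (suc i) + + 1)
                             (inner≡ i) (fires (suc i) Yi))

  -- Rigidity of semiorientations

  semiorientation⇒rigid : ∀ (𝒪 : PartialOrientation G) → IsSemiorientation 𝒪 →
                  Rigid (adj G) (λ i → + indeg 𝒪 (suc i) - + 1)
  semiorientation⇒rigid 𝒪 semi Y (i , Yi) fires
    with backward-walk {R = λ u v → O 𝒪 u v ≡ true} loopless asym
                       (λ v → Y⁺ v ≡ true) (λ {v} → pred v) {suc i} Yi
    where
    Y⁺ : Fin (suc n) → Bool
    Y⁺ zero    = false
    Y⁺ (suc j) = Y j

    loopless : ∀ {u} → O 𝒪 u u ≢ true
    loopless {u} Ouu = not-¬ (antisym 𝒪 u u Ouu) Ouu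

    asym : ∀ {u v} → O 𝒪 u v ≡ true → O 𝒪 v u ≢ true
    asym {u} {v} Ouv = not-¬ (antisym 𝒪 u v Ouv)

    excess : ∀ {r m} → + r ≤ + m - + 1 → r ℕ.< m
    excess {m = zero}  ()
    excess {m = suc m} (ℤ.+≤+ r≤m) = s≤s r≤m

    pred : ∀ v → Y⁺ v ≡ true → ∃ λ u → Y⁺ u ≡ true × O 𝒪 u v ≡ true
    -- Fewer neighbours lie outside `Y` than edges enter the vertex, so some entering edge starts
    -- inside `Y`.
    pred (suc j) Yj with count-excess {p = λ u → adj G (suc j) u ∧ not (Y⁺ u)} {λ u → O 𝒪 u (suc j)}
        (excess (subst (_≤ + indeg 𝒪 (suc j) - + 1)
                       (trans (cong (λ k → + k - + count (λ i → Y i ∧ adj G (suc j) (suc i)))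
                                    (count-split (adj G (suc j)) Y⁺))
                              (+[m+n]-n _ (count (λ i → Y i ∧ adj G (suc j) (suc i)))))
                       (fires j Yj)))
    ... | u , Ouj , inside = u , Y⁺u , Ouj
      where
      Y⁺u : Y⁺ u ≡ true
      Y⁺u with Y⁺ u | trans (cong (_∧ not (Y⁺ u))
                                  (sym (trans (symmetric G (suc j) u) (onEdge 𝒪 u (suc j) Ouj)))) inside
      ... | true | _ = refl
  ... | c , long , unique , directed =
    -- A directed cycle is potential and has no blank edge, so `semi` would put a count strictly
    -- below zero.
    ℕ.n≮0 (subst (countEdges (oriented 𝒪) (cycEdges c) ℕ.<_) no-blank (semi C potential))
    where
    C : Cycle G
    C = record { verts = c ; long = long ; distinct = unique
               ; edges = All.map (λ {e} → onEdge 𝒪 (proj₁ e) (proj₂ e)) directed }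
    potential : Potential 𝒪 C
    potential = All.map (λ {e} → antisym 𝒪 (proj₁ e) (proj₂ e)) directed
    no-blank : countEdges (blank 𝒪) (cycEdges c) ≡ 0
    no-blank = countEdges-none (blank 𝒪) (cycEdges c) (All.map (λ {e} Oe → not-blank Oe) directed)
      where
      not-blank : ∀ {u v} → O 𝒪 u v ≡ true → blank 𝒪 u v ≡ false
      not-blank {u} {v} Ouv rewrite Ouv = ∧-zeroʳ (adj G u v)

  -- The common normal form of all the sets of the theorem.
  Admissible : (Fin n → ℤ → Set) → Config n → Set
  Admissible L c = (∀ i → L i (c i)) × Rigid (adj G) c

  AtLeast-X AtLeast-0 : Fin n → ℤ → Set
  AtLeast-X i z = + 0 ≤ z + oneXc G i
  AtLeast-0 i z = + 0 ≤ z

  Normal : (Fin n → ℤ → Set) → Divisor n → Set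
  Normal L d = d zero ≡ - (+ 1) × Admissible L (d ∘ suc)

  oneXc-adj : ∀ i → adj G zero (suc i) ≡ true → oneXc G i ≡ + 0
  oneXc-adj i 0~i rewrite 0~i = refl

  0≤oneX : ∀ v → + 0 ≤ oneX G v
  0≤oneX v with inX G v
  ... | true  = ℤ.+≤+ z≤n
  ... | false = ℤ.+≤+ z≤n

  oneX≤1 : ∀ v → oneX G v ≤ + 1
  oneX≤1 v with inX G v
  ... | true  = ℤ.+≤+ (s≤s z≤n)
  ... | false = ℤ.+≤+ z≤n

  shifted⇔normal : ∀ {P : Config n → Set} L → (∀ c → P c ⇔ Admissible L c) →
                   ∀ d → ShiftedSet P d ⇔ Normal L d
  shifted⇔normal {P} L P⇔ d = mk⇔ to from
    where
    to : ShiftedSet P d → Normal L d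
    to (c , Pc , d≗) with Equivalence.to (P⇔ c) Pc
    ... | lower , rigid = d≗ zero , (λ i → subst (L i) (sym (d≗ (suc i))) (lower i)) ,
                          rigid-cong {H = adj G} (λ i → sym (d≗ (suc i))) rigid
    from : Normal L d → ShiftedSet P d
    from (d₀ , adm) = d ∘ suc , Equivalence.from (P⇔ (d ∘ suc)) adm , λ { zero → d₀ ; (suc i) → refl }

  K₀-superstable⇔ : ∀ c → Superstable (K₀ G) (λ i → c i + oneXc G i) ⇔ Admissible AtLeast-X c
  K₀-superstable⇔ c = mk⇔
    (λ st → let lower , rigid = Equivalence.to (superstable⇔rigid (K₀ G) _) st in
            lower , λ Y ne → rigid Y ne ∘ Equivalence.from (K₀-fires c Y))
    (λ (lower , rigid) → Equivalence.from (superstable⇔rigid (K₀ G) _)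
            (lower , λ Y ne → rigid Y ne ∘ Equivalence.to (K₀-fires c Y)))

  0⇒X : ∀ (c : Config n) → (∀ i → AtLeast-0 i (c i)) → ∀ i → AtLeast-X i (c i)
  0⇒X c lower i = ℤ.+-mono-≤ (lower i) (0≤oneX (suc i))

  K₀-superstable-≥0⇔ : ∀ c → (Superstable (K₀ G) (λ i → c i + oneXc G i) × (∀ i → + 0 ≤ c i)) ⇔
                             Admissible AtLeast-0 c
  K₀-superstable-≥0⇔ c = mk⇔
    (λ (st , c≥0) → c≥0 , proj₂ (Equivalence.to (K₀-superstable⇔ c) st))
    (λ (c≥0 , rigid) → Equivalence.from (K₀-superstable⇔ c) (0⇒X c c≥0 , rigid) , c≥0)

  quasi⇔ : ∀ d → d zero ≡ - (+ 1) →
           QuasiSuperstable G d ⇔ ((∀ v → + 0 ≤ d v + + 1) × Rigid (adj G) (d ∘ suc))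
  quasi⇔ d d₀ = mk⇔
    (λ q → let lower , rigid = Equivalence.to (superstable⇔rigid (K G) _) q in
           lower , Equivalence.to (K-rigid d d₀) rigid)
    (λ (lower , rigid) → Equivalence.from (superstable⇔rigid (K G) _)
           (lower , Equivalence.from (K-rigid d d₀) rigid))

  -- Because 1_X is at most 1 everywhere, the bound by -1_X yields the nonnegativity part of
  -- quasi-superstability.
  X⇒≥-1 : ∀ (d : Divisor n) → d zero ≡ - (+ 1) → (∀ i → AtLeast-X i (d (suc i))) → ∀ v → + 0 ≤ d v + + 1
  X⇒≥-1 d d₀ lower zero    = ℤ.≤-reflexive (sym (cong (_+ + 1) d₀))
  X⇒≥-1 d d₀ lower (suc i) = ℤ.≤-trans (lower i) (ℤ.+-monoʳ-≤ (d (suc i)) (oneX≤1 (suc i)))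

  S₀⇔normal : ∀ d → S₀ G d ⇔ Normal AtLeast-X d
  S₀⇔normal d = mk⇔ to from
    where
    to : S₀ G d → Normal AtLeast-X d
    to (q , d₀ , lower) = d₀ , lower′ , proj₂ (Equivalence.to (quasi⇔ d d₀) q)
      where
      lower′ : ∀ i → AtLeast-X i (d (suc i))
      lower′ i = subst₂ _≤_ (ℤ.+-inverseˡ (oneXc G i)) (cong (_+ oneXc G i) (ℤ.+-identityʳ (d (suc i))))
                        (ℤ.+-monoˡ-≤ (oneXc G i) (lower (suc i)))
    from : Normal AtLeast-X d → S₀ G d
    from (d₀ , lower , rigid) = Equivalence.from (quasi⇔ d d₀) (X⇒≥-1 d d₀ lower , rigid) , d₀ , lower′
      where
      lower′ : ∀ v → - oneX G v ≤ d v + v₀ v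
      lower′ zero rewrite d₀ = ℤ.+≤+ z≤n
      lower′ (suc i) = subst₂ _≤_ (ℤ.+-identityˡ _) cancel (ℤ.+-monoˡ-≤ (- oneXc G i) (lower i))
        where
        cancel : (d (suc i) + oneXc G i) - oneXc G i ≡ d (suc i) + + 0
        cancel = trans (ℤ.+-assoc (d (suc i)) _ _) (cong (ℤ._+_ (d (suc i))) (ℤ.+-inverseʳ (oneXc G i)))

  S̃₀⇔normal : ∀ d → S̃₀ G d ⇔ Normal AtLeast-0 d
  S̃₀⇔normal d = mk⇔
    (λ (q , d₀ , lower) → d₀ , (λ i → subst (+ 0 ≤_) (ℤ.+-identityʳ (d (suc i))) (lower (suc i))) ,
                          proj₂ (Equivalence.to (quasi⇔ d d₀) q))
    (λ (d₀ , lower , rigid) → Equivalence.from (quasi⇔ d d₀) (X⇒≥-1 d d₀ (0⇒X (d ∘ suc) lower) , rigid) , d₀ ,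
      λ { zero    → ℤ.≤-reflexive (sym (cong (_+ + 1) d₀))
        ; (suc i) → subst (+ 0 ≤_) (sym (ℤ.+-identityʳ (d (suc i)))) (lower i) })

  parking⇔normal : ∀ d → ParkingFunction G d ⇔ Normal AtLeast-0 d
  parking⇔normal d = mk⇔
    (λ (d₀ , st) → d₀ , Equivalence.to (superstable⇔rigid (adj G) _) st)
    (λ (d₀ , adm) → d₀ , Equivalence.from (superstable⇔rigid (adj G) _) adm)

  -- The images of ψ

  -- The edges oriented out of v₀ are among all its edges; equal numbers leave none out.
  source-edges : ∀ (𝒪 : PartialOrientation G) → outdeg 𝒪 zero ≡ deg (adj G) zero →
                 ∀ v → adj G zero v ≡ true → O 𝒪 zero v ≡ true
  source-edges 𝒪 out v 0~v = ¬-not λ 0↛v →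
    ℕ.<⇒≢ (count-mono-< (λ u → onEdge 𝒪 zero u) v 0↛v 0~v) out

  -- With every edge at v₀ leaving it, its neighbours have in-degree at least 1 and the other
  -- vertices at least 0. Lowered by 1, this is the bound by -1_X; conversely that bound supplies
  -- the hypothesis of `realise`.
  image⇔normal : ∀ d → ImageΨ G In𝕆₀ d ⇔ Normal AtLeast-X d
  image⇔normal d = mk⇔ to from
    where
    to : ImageΨ G In𝕆₀ d → Normal AtLeast-X d
    to (𝒪 , (semi , out) , d≗) =
      trans (d≗ zero) (cong (λ k → + k - + 1) indeg₀) , lower ,
      rigid-cong {H = adj G} (λ i → sym (d≗ (suc i))) (semiorientation⇒rigid 𝒪 semi)
      where
      indeg₀ : indeg 𝒪 zero ≡ 0
      indeg₀ = count-none λ u → ¬-not λ Ou0 → not-¬ (antisym 𝒪 u zero Ou0)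
        (source-edges 𝒪 out u (trans (symmetric G zero u) (onEdge 𝒪 u zero Ou0)))
      lower : ∀ i → AtLeast-X i (d (suc i))
      lower i with adj G zero (suc i) in 0~i
      ... | true  = subst (+ 0 ≤_) (sym (trans (ℤ.+-identityʳ _) (d≗ (suc i))))
                      (ℤ.i≤j⇒0≤j-i (ℤ.+≤+ (count-≥1 {p = λ u → O 𝒪 u (suc i)} zero (source-edges 𝒪 out (suc i) 0~i))))
      ... | false = subst (λ z → + 0 ≤ z + + 1) (sym (d≗ (suc i)))
                      (subst (+ 0 ≤_) (sym (trans (ℤ.+-assoc (+ indeg 𝒪 (suc i)) (- (+ 1)) (+ 1))
                                                  (ℤ.+-identityʳ (+ indeg 𝒪 (suc i)))))
                             (ℤ.+≤+ z≤n))

    from : Normal AtLeast-X d → ImageΨ G In𝕆₀ d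
    from (d₀ , lower , rigid) = 𝒪 , in𝕆₀ , λ v → trans (d≡ v) (cong (λ k → + k - + 1) (sym (indeg≡ v)))
      where
      f : Fin (suc n) → ℕ
      -- The in-degree that ψ requires; the absolute value only changes the type, as `d v + 1` is
      -- nonnegative.
      f v = ℤ.∣ d v + + 1 ∣

      +f≡ : ∀ v → + f v ≡ d v + + 1
      +f≡ v = ℤ.0≤i⇒+∣i∣≡i (X⇒≥-1 d d₀ lower v)

      d≡ : ∀ v → d v ≡ + f v - + 1
      d≡ v = sym (trans (cong (_- + 1) (+f≡ v)) (trans (ℤ.+-assoc (d v) _ _) (ℤ.+-identityʳ (d v))))

      f≥1 : ∀ i → adj G zero (suc i) ≡ true → 1 ℕ.≤ f (suc i)
      f≥1 i 0~i = ℤ.drop‿+≤+ (subst (+ 1 ≤_) (sym (+f≡ (suc i))) (ℤ.+-monoˡ-≤ (+ 1) d≥0))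
        where
        d≥0 : + 0 ≤ d (suc i)
        d≥0 = subst (+ 0 ≤_) (trans (cong (ℤ._+_ (d (suc i))) (oneXc-adj i 0~i)) (ℤ.+-identityʳ _)) (lower i)

      realised = Burning.realise G f (cong (λ z → ℤ.∣ z + + 1 ∣) d₀)
                   (rigid-cong {H = adj G} (d≡ ∘ suc) rigid) f≥1
      𝒪      = proj₁ realised
      in𝕆₀   = proj₁ (proj₂ realised)
      indeg≡ = proj₂ (proj₂ realised)

  normal-0⇒X : ∀ d → Normal AtLeast-0 d → Normal AtLeast-X d
  normal-0⇒X d (d₀ , lower , rigid) = d₀ , 0⇒X (d ∘ suc) lower , rigid

  -- The same orientation serves as in `image⇔normal`: in-degree at least 1 is nonnegativity of `d`
  -- read through ψ.
  image~⇔normal : ∀ d → ImageΨ G In𝕆̃₀ d ⇔ Normal AtLeast-0 d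
  image~⇔normal d = mk⇔ to from
    where
    to : ImageΨ G In𝕆̃₀ d → Normal AtLeast-0 d
    to (𝒪 , (in𝕆₀ , indeg≥1) , d≗) with Equivalence.to (image⇔normal d) (𝒪 , in𝕆₀ , d≗)
    ... | d₀ , _ , rigid =
      d₀ , (λ i → subst (+ 0 ≤_) (sym (d≗ (suc i))) (ℤ.i≤j⇒0≤j-i (ℤ.+≤+ (indeg≥1 i)))) , rigid
    from : Normal AtLeast-0 d → ImageΨ G In𝕆̃₀ d
    from normal@(_ , lower , _) with Equivalence.from (image⇔normal d) (normal-0⇒X d normal)
    ... | 𝒪 , in𝕆₀ , d≗ =
      𝒪 , (in𝕆₀ , λ i → ℤ.drop‿+≤+ (ℤ.0≤i-j⇒j≤i (subst (+ 0 ≤_) (d≗ (suc i)) (lower i)))) , d≗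

theorem4p3 : ∀ (n : ℕ) (G : Graph n) →
    (∀ d → (ImageΨ G In𝕆₀ d ⇔ ShiftedSet (λ c → Superstable (K₀ G) (λ i → c i + oneXc G i)) d)
    × (ShiftedSet (λ c → Superstable (K₀ G) (λ i → c i + oneXc G i)) d ⇔ S₀ G d))
    ×
    (∀ d → (S̃₀ G d → S₀ G d)
    × (ImageΨ G In𝕆̃₀ d ⇔ ShiftedSet (λ c → Superstable (adj G) c) d)
    × (ShiftedSet (λ c → Superstable (adj G) c) d
    ⇔ ShiftedSet (λ c → Superstable (K₀ G) (λ i → c i + oneXc G i) × (∀ i → + 0 ≤ c i)) d)
    × (ShiftedSet (λ c → Superstable (K₀ G) (λ i → c i + oneXc G i) × (∀ i → + 0 ≤ c i)) d
    ⇔ S̃₀ G d)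
    × (S̃₀ G d ⇔ ParkingFunction G d))
theorem4p3 n G =
    (λ d → via (image⇔normal G d) (shifted d) , via (shifted d) (S₀⇔normal G d))
  , (λ d → Equivalence.from (S₀⇔normal G d) ∘ normal-0⇒X G d ∘ Equivalence.to (S̃₀⇔normal G d)
         , via (image~⇔normal G d) (superstable d)
         , via (superstable d) (shifted-≥0 d)
         , via (shifted-≥0 d) (S̃₀⇔normal G d)
         , via (S̃₀⇔normal G d) (parking⇔normal G d))
  where
  via : ∀ {A B C : Set} → A ⇔ C → B ⇔ C → A ⇔ B
  via A⇔C B⇔C = ⇔-sym B⇔C ⇔-∘ A⇔C
  shifted     = shifted⇔normal G (AtLeast-X G) (K₀-superstable⇔ G)
  superstable = shifted⇔normal G (AtLeast-0 G) (superstable⇔rigid (adj G))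
  shifted-≥0  = shifted⇔normal G (AtLeast-0 G) (K₀-superstable-≥0⇔ G)
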